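{- Let $\mathcal{A}=\{A_1,\dots,A_m\}$ be a bimodal collection of pairwise disjoint nonempty subsets of a finite abelian group $G$, with internal difference groups $H_1,\dots,H_m$, such that $|A_i|=|H_i|$ for every $i$. Let $H=H_1+H_2+\dots+H_m$. Then each $A_i$ is a coset of $H_i$, and the sets $A_1,\dots,A_m$ arise from a subdivision of cosets of $H$, i.e. $A_1\cup\dots\cup A_m$ is a union of cosets of $H$ and each $A_i$ is contained in a single coset of $H$.
   Context: $G$ is written additively. The internal difference group $H_i$ of $A_i$ is the subgroup generated by all $x-y$ with $x,y\in A_i$; $A_i$ lies in a single coset of $H_i$ and $|A_i|\le|H_i|$. A collection $\{A_1,\dots,A_m\}$ of pairwise disjoint subsets of $G$ is bimodal if for every $i$ and every $\delta\in G\setminus\{0\}$, the number $N_i(\delta)$ of pairs $(a,b)$ with $a\in A_i$, $b\in A_j$ for some $j\neq i$, and $a-b=\delta$, satisfies $N_i(\delta)\in\{0,|A_i|\}$. -}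

module Defs where

open import Level using (Level; _⊔_)
open import Algebra.Bundles using (AbelianGroup)
open import Data.Nat.Base using (ℕ)
open import Data.Fin.Base using (Fin)
open import Data.Product.Base using (∃; ∃-syntax; Σ-syntax; _×_; _,_; proj₁)
open import Data.Product.Relation.Binary.Pointwise.NonDependent using (_×ₛ_)
open import Data.Sum.Base using (_⊎_)
open import Function.Bundles using (Inverse)
open import Relation.Binary.Bundles using (Setoid)
import Relation.Binary.Construct.On as On
open import Relation.Binary.PropositionalEquality using (_≡_; _≢_)
import Relation.Binary.PropositionalEquality.Properties as ≡
open import Relation.Nullary.Negation using (¬_)
open import Relation.Unary using (Pred; _∈_; _≐_; ⋃)

private
  variable
    a e p q : Level

HasSize : Setoid a e → ℕ → Set (a ⊔ e)
HasSize S n = Inverse S (≡.setoid (Fin n))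

Finite : Setoid a e → Set (a ⊔ e)
Finite S = ∃[ n ] HasSize S n

-- Elements are counted up to the setoid equality: two membership proofs of
-- the same element count once.
Card : (S : Setoid a e) → Pred (Setoid.Carrier S) p → ℕ → Set (a ⊔ e ⊔ p)
Card S P n = HasSize (On.setoid S (proj₁ {B = P})) n

module Collections {c ℓ : Level} (G : AbelianGroup c ℓ) where

  open AbelianGroup G
    using (Carrier; _≈_; setoid; commutativeMonoid; _-_)
    renaming (_∙_ to _+_; ε to 0#; _⁻¹ to -_)
  open import Algebra.Properties.CommutativeMonoid.Sum commutativeMonoid
    using (sum)

  data Generated (S : Pred Carrier p) : Pred Carrier (c ⊔ ℓ ⊔ p) where
    gen  : ∀ {x} → x ∈ S → x ∈ Generated S
    zero : 0# ∈ Generated S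
    add  : ∀ {x y} → x ∈ Generated S → y ∈ Generated S → (x + y) ∈ Generated S
    neg  : ∀ {x} → x ∈ Generated S → (- x) ∈ Generated S
    resp : ∀ {x y} → x ≈ y → x ∈ Generated S → y ∈ Generated S

  Differences : Pred Carrier p → Pred Carrier (c ⊔ ℓ ⊔ p)
  Differences A z = ∃[ x ] ∃[ y ] x ∈ A × y ∈ A × z ≈ x - y

  InternalDifferenceGroup : Pred Carrier p → Pred Carrier (c ⊔ ℓ ⊔ p)
  InternalDifferenceGroup A = Generated (Differences A)

  SubgroupSum : ∀ {m} → (Fin m → Pred Carrier p) → Pred Carrier (c ⊔ ℓ ⊔ p)
  SubgroupSum {m = m} K x =
    Σ[ h ∈ (Fin m → Carrier) ] (∀ i → h i ∈ K i) × x ≈ sum h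

  infix 6 _⊕_
  _⊕_ : Carrier → Pred Carrier p → Pred Carrier (c ⊔ ℓ ⊔ p)
  (g ⊕ K) x = ∃[ k ] k ∈ K × x ≈ g + k

  _IsCosetOf_ : Pred Carrier p → Pred Carrier q → Set (c ⊔ ℓ ⊔ p ⊔ q)
  A IsCosetOf K = ∃[ g ] A ≐ (g ⊕ K)

  -- R is a set of (not necessarily distinct) coset representatives.
  _IsUnionOfCosetsOf_ : Pred Carrier p → Pred Carrier q →
                        Set (c ⊔ ℓ ⊔ Level.suc p ⊔ q)
  _IsUnionOfCosetsOf_ {p = p} A K =
    Σ[ R ∈ Pred Carrier p ] A ≐ ⋃ (∃ R) (λ r → proj₁ r ⊕ K)

  -- The pairs counted by N_i(δ).
  DifferencePairs : ∀ {m} → (Fin m → Pred Carrier p) → Fin m → Carrier →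
                    Pred (Carrier × Carrier) (ℓ ⊔ p)
  DifferencePairs A i δ (a , b) =
    a ∈ A i × (∃[ j ] j ≢ i × b ∈ A j) × a - b ≈ δ

  Bimodal : ∀ {m} → (Fin m → Pred Carrier p) → Set (c ⊔ ℓ ⊔ p)
  Bimodal A = ∀ i δ → ¬ (δ ≈ 0#) →
    ∃[ N ] Card (setoid ×ₛ setoid) (DifferencePairs A i δ) N
         × (N ≡ 0 ⊎ Card setoid (A i) N)

{-# OPTIONS --safe #-}

-- Translation by an element of A i embeds A i in H i, so equality of the
-- cardinalities makes A i closed under adding elements of H i.  If x ∈ A i,
-- b ∈ A j and i ≢ j, then b - x occurs as a difference leaving A j, hence by
-- bimodality every b + h ∈ A j with h ∈ H j is the left end of such a
-- difference; its right end is (b + h) - (b - x) = x + h.  Thus the union of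
-- the A i is closed under adding elements of every H j, and so of H.
module Submission where

open import Defs
open import Algebra.Bundles using (AbelianGroup)
open import Data.Nat.Base using (ℕ; zero; suc)
open import Data.Nat.Properties using (1+n≰n)
open import Data.Fin.Base using (Fin; zero; suc; punchOut)
open import Data.Fin.Properties using (_≟_; any?; ¬Fin0; injective⇒≤; punchOut-injective)
open import Data.Product.Base using (∃-syntax; _×_; _,_; proj₁; proj₂)
open import Data.Product.Relation.Binary.Pointwise.NonDependent using (_×ₛ_)
open import Data.Sum.Base using (inj₁; inj₂)
open import Data.Vec.Functional using (_∷_)
open import Function.Base using (_∘_)
open import Function.Bundles using (Inverse)
open import Function.Definitions using (Injective)
open import Level using (Level)
open import Relation.Binary.Bundles using (Setoid)
import Relation.Binary.Construct.On as On
open import Relation.Binary.Definitions using (_Respects_)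
open import Relation.Binary.PropositionalEquality as ≡ using (_≡_; _≢_)
open import Relation.Nullary.Decidable using (yes; no)
open import Relation.Nullary.Negation using (¬_; contradiction)
open import Relation.Unary using (Pred; Satisfiable; _∈_; _⊥_; _⊆_; ⋃)

private
  variable
    a b e f p : Level

-- Pigeonhole: if `y` were missed, punching it out of the codomain would leave an injection from
-- `Fin (suc n)` into `Fin n`.
injective⇒strictlySurjective : ∀ {n} {g : Fin n → Fin n} → Injective _≡_ _≡_ g →
                               ∀ y → ∃[ x ] g x ≡ y
injective⇒strictlySurjective {zero} _ y = contradiction y ¬Fin0
injective⇒strictlySurjective {suc n} {g} g-inj y with any? (λ x → g x ≟ y)
... | yes hit = hit
... | no miss = contradiction (injective⇒≤ {f = λ x → punchOut (y≢g x)} avoid-inj) 1+n≰n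
  where
  y≢g : ∀ x → y ≢ g x
  y≢g x y≡gx = miss (x , ≡.sym y≡gx)

  avoid-inj : Injective _≡_ _≡_ (λ x → punchOut (y≢g x))
  avoid-inj eq = g-inj (punchOut-injective (y≢g _) (y≢g _) eq)

module _ (S : Setoid a e) (T : Setoid b f) where
  private
    module S = Setoid S
    module T = Setoid T

  -- The two enumerations turn `g` into an injective self-map of `Fin n`, which hits the index of
  -- `y`.
  equinumerous-injective⇒strictlySurjective :
    ∀ {n} → HasSize S n → HasSize T n →
    {g : S.Carrier → T.Carrier} → Injective S._≈_ T._≈_ g →
    ∀ y → ∃[ x ] g x T.≈ y
  equinumerous-injective⇒strictlySurjective σ τ {g} g-inj y =
    let i , eq = injective⇒strictlySurjective index-inj (τ.to y)
    in σ.from i , τ-inj eq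
    where
    module σ = Inverse σ
    module τ = Inverse τ

    τ-inj : Injective T._≈_ _≡_ τ.to
    τ-inj {u} {v} eq = T.trans (T.sym (τ.inverseʳ ≡.refl)) (τ.inverseʳ eq)

    index-inj : Injective _≡_ _≡_ (τ.to ∘ g ∘ σ.from)
    index-inj {i} {j} eq =
      ≡.trans (≡.sym (σ.inverseˡ S.refl)) (σ.inverseˡ (g-inj (τ-inj eq)))

module _ {c ℓ : Level} (G : AbelianGroup c ℓ) where

  open AbelianGroup G
    renaming (_∙_ to _+_; ε to 0#; _⁻¹ to -_; ∙-congˡ to +-congˡ; ∙-congʳ to +-congʳ;
              identityˡ to +-identityˡ; identityʳ to +-identityʳ; assoc to +-assoc;
              comm to +-comm)
  open Collections G
  open import Algebra.Properties.AbelianGroup G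
  open import Algebra.Properties.CommutativeMonoid.Sum commutativeMonoid
    using (sum; sum-replicate-zero)
  open import Relation.Binary.Reasoning.Setoid setoid

  x+[y-x]≈y : ∀ x y → x + (y - x) ≈ y
  x+[y-x]≈y x y = trans (sym (+-assoc x y (- x))) (xyx⁻¹≈y x y)

  -- The summands are added one at a time; `x` is general because the running total moves while `P`
  -- stays fixed.
  sum-closed : ∀ {P : Pred Carrier p} → P Respects _≈_ →
               ∀ {m} (h : Fin m → Carrier) → (∀ i {x} → x ∈ P → x + h i ∈ P) →
               ∀ {x} → x ∈ P → x + sum h ∈ P
  sum-closed resp-P {zero} h closed x∈P = resp-P (sym (+-identityʳ _)) x∈P
  sum-closed resp-P {suc m} h closed x∈P =
    resp-P (+-assoc _ _ _)
      (sum-closed resp-P (h ∘ suc) (closed ∘ suc) (closed zero x∈P))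

  -- The witness is the family carrying `x` at `i` and `0#` elsewhere.
  summand⊆SubgroupSum : ∀ {m} (K : Fin m → Pred Carrier p) → (∀ i → 0# ∈ K i) →
                        ∀ i → K i ⊆ SubgroupSum K
  summand⊆SubgroupSum {m = suc m} K 0∈K zero {x} x∈K =
    x ∷ (λ _ → 0#) ,
    (λ where
      zero → x∈K
      (suc i) → 0∈K (suc i)) ,
    trans (sym (+-identityʳ x)) (+-congˡ (sym (sum-replicate-zero m)))
  summand⊆SubgroupSum K 0∈K (suc i) x∈K =
    let h , h∈K , x≈∑h = summand⊆SubgroupSum (K ∘ suc) (0∈K ∘ suc) i x∈K
    in 0# ∷ h ,
       (λ where
         zero → 0∈K zero
         (suc j) → h∈K j) ,
       trans x≈∑h (sym (+-identityˡ (sum h)))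

  ⊆-coset : ∀ {A : Pred Carrier p} {x} → x ∈ A → A ⊆ (x ⊕ InternalDifferenceGroup A)
  ⊆-coset {x = x} x∈A {y} y∈A =
    y - x , gen (y , x , y∈A , x∈A , refl) , sym (x+[y-x]≈y x y)

  -- The map sending `y` to `y - x` injects `A` into its difference group; equal sizes make it onto,
  -- so `h` is some `y - x` and `x + h` is that `y`.
  equinumerous⇒closed :
    ∀ {A : Pred Carrier p} → A Respects _≈_ →
    ∀ {k} → Card setoid A k → Card setoid (InternalDifferenceGroup A) k →
    ∀ {x h} → x ∈ A → h ∈ InternalDifferenceGroup A → x + h ∈ A
  equinumerous⇒closed resp-A |A| |H| {x} {h} x∈A h∈H =
    let (y , y∈A) , y-x≈h =
          equinumerous-injective⇒strictlySurjective
            (On.setoid setoid proj₁) (On.setoid setoid proj₁) |A| |H|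
            {λ (y , y∈A) → y - x , gen (y , x , y∈A , x∈A , refl)}
            (∙-cancelʳ (- x) _ _) (h , h∈H)
    in resp-A (trans (sym (x+[y-x]≈y x y)) (+-congˡ y-x≈h)) y∈A

  -- One pair excludes the count 0, so there are as many pairs as elements of `A i`. Taking left
  -- ends is injective, hence every `a` in `A i` is a left end.
  bimodal⇒translate :
    ∀ {m} {A : Fin m → Pred Carrier p} → Bimodal A →
    ∀ {i δ} → ¬ (δ ≈ 0#) → Satisfiable (DifferencePairs A i δ) →
    ∀ {a} → a ∈ A i → ∃[ b ] b ∈ ⋃ (Fin m) A × a - b ≈ δ
  bimodal⇒translate {A = A} bimodal {i} {δ} δ≉0 pair {a} a∈A with bimodal i δ δ≉0
  -- A count of 0 would give the known pair an index in `Fin 0`.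
  ... | _ , |D| , inj₁ ≡.refl = contradiction (Inverse.to |D| (_ , proj₂ pair)) ¬Fin0
  ... | _ , |D| , inj₂ |A| =
    let ((_ , b) , _ , (j , _ , b∈A) , a′-b≈δ) , a′≈a =
          equinumerous-injective⇒strictlySurjective pairs elements |D| |A|
            {left} (λ {u} {v} → left-inj {u} {v}) (a , a∈A)
    in b , (j , b∈A) , trans (+-congʳ (sym a′≈a)) a′-b≈δ
    where
    pairs = On.setoid (setoid ×ₛ setoid) (proj₁ {B = DifferencePairs A i δ})
    elements = On.setoid setoid (proj₁ {B = A i})

    left : Setoid.Carrier pairs → Setoid.Carrier elements
    left ((a , _) , a∈A , _) = a , a∈A

    left-inj : Injective (Setoid._≈_ pairs) (Setoid._≈_ elements) left
    left-inj {(a , b) , _ , _ , a-b≈δ} {(a′ , b′) , _ , _ , a′-b′≈δ} a≈a′ =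
      -- With `δ` fixed, the left end determines the right end.
      a≈a′ , ⁻¹-injective (∙-cancelˡ a (- b) (- b′)
        (trans a-b≈δ (trans (sym a′-b′≈δ) (+-congʳ (sym a≈a′)))))

  module _ {m} {A : Fin m → Pred Carrier p}
           (resp-A : ∀ i → A i Respects _≈_)
           (disjoint : ∀ i j → i ≢ j → A i ⊥ A j)
           (bimodal : Bimodal A)
    where

    private
      U = ⋃ (Fin m) A
      K = λ i → InternalDifferenceGroup (A i)

    ⋃-closed : (∀ i {x h} → x ∈ A i → h ∈ K i → x + h ∈ A i) →
               (∀ i → Satisfiable (A i)) →
               ∀ j {h} → h ∈ K j → ∀ {x} → x ∈ U → x + h ∈ U
    ⋃-closed closed inhabited j {h} h∈K {x} (i , x∈A) with i ≟ j
    ... | yes ≡.refl = i , closed i x∈A h∈K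
    ... | no i≢j =
      let b , b∈A = inhabited j
          -- Bimodality speaks only of nonzero differences; a zero one would put `b` in both `A i`
          -- and `A j`.
          b-x≉0 = λ b-x≈0 → disjoint i j i≢j
            (x∈A , resp-A j (x∙y⁻¹≈ε⇒x≈y b x b-x≈0) b∈A)
          -- Bimodality is applied to `A j`, the set whose group contains `h`. The right end `y`
          -- paired with `b + h` may lie in any `A l`.
          y , (l , y∈A) , b+h-y≈b-x =
            bimodal⇒translate bimodal b-x≉0
              ((b , x) , b∈A , (i , i≢j , x∈A) , refl) (closed j b∈A h∈K)
      in l , resp-A l (cancel b+h-y≈b-x) y∈A
      where
      cancel : ∀ {b y} → (b + h) - y ≈ b - x → y ≈ x + h
      cancel {b} {y} eq = sym (∙-cancelˡ b _ _ (begin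
        b + (x + h)           ≈⟨ +-congˡ (+-comm x h) ⟩
        b + (h + x)           ≈⟨ +-assoc b h x ⟨
        (b + h) + x           ≈⟨ +-congʳ (//-rightDividesˡ y (b + h)) ⟨
        ((b + h) - y) + y + x ≈⟨ +-congʳ (+-congʳ eq) ⟩
        (b - x) + y + x       ≈⟨ +-assoc (b - x) y x ⟩
        (b - x) + (y + x)     ≈⟨ +-congˡ (+-comm y x) ⟩
        (b - x) + (x + y)     ≈⟨ +-assoc (b - x) x y ⟨
        (b - x) + x + y       ≈⟨ +-congʳ (//-rightDividesˡ x b) ⟩
        b + y                 ∎))

theorem3p18 :
    ∀ {c ℓ p} (G : AbelianGroup c ℓ) →
    let open AbelianGroup G
        open Collections G
    in
    Finite setoid →
    (m : ℕ) (A : Fin m → Pred Carrier p) →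
    (∀ i → A i Respects _≈_) →
    (∀ i → Satisfiable (A i)) →
    (∀ i j → i ≢ j → A i ⊥ A j) →
    Bimodal A →
    let Hᵢ : Fin m → Pred Carrier _
        Hᵢ i = InternalDifferenceGroup (A i)
        H = SubgroupSum Hᵢ
    in
    (∀ i → ∃[ k ] Card setoid (A i) k × Card setoid (Hᵢ i) k) →
    (∀ i → A i IsCosetOf Hᵢ i)
    × (⋃ (Fin m) A) IsUnionOfCosetsOf H
    × (∀ i → ∃[ g ] A i ⊆ (g ⊕ H))
theorem3p18 G _ m A resp-A inhabited disjoint bimodal sizes =
  (λ i → let g , g∈A = inhabited i in
    g , ⊆-coset G g∈A ,
    λ (k , k∈K , x≈g+k) → resp-A i (sym x≈g+k) (closed i g∈A k∈K)) ,
  -- Every element of `U` serves as a representative of its own coset, so only the inclusion of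
  -- these cosets in `U` has content.
  (U , (λ {x} x∈U → (x , x∈U) , 0# , 0∈H , sym (identityʳ x)) , coset⊆U) ,
  -- `A i` lies in `g ⊕ K i`, and `K i` lies in `H`.
  (λ i → let g , g∈A = inhabited i in
    g , λ x∈A → let k , k∈K , x≈g+k = ⊆-coset G g∈A x∈A in
      k , summand⊆SubgroupSum G K (λ _ → zero) i k∈K , x≈g+k)
  where
  open AbelianGroup G renaming (ε to 0#)
  open Collections G

  U = ⋃ (Fin m) A
  K = λ i → InternalDifferenceGroup (A i)
  H = SubgroupSum K

  closed : ∀ i {x h} → x ∈ A i → h ∈ K i → x ∙ h ∈ A i
  closed i = let _ , |A| , |K| = sizes i in equinumerous⇒closed G (resp-A i) |A| |K|

  resp-U : U Respects _≈_
  resp-U x≈y (i , x∈A) = i , resp-A i x≈y x∈A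

  0∈H : 0# ∈ H
  0∈H = (λ _ → 0#) , (λ _ → zero) , sym (sum-replicate-zero m)
    where
    open import Algebra.Properties.CommutativeMonoid.Sum commutativeMonoid

  coset⊆U : ⋃ (∃[ r ] r ∈ U) (λ r → proj₁ r ⊕ H) ⊆ U
  coset⊆U ((r , r∈U) , k , (h , h∈K , k≈∑h) , x≈r+k) =
    resp-U (sym (trans x≈r+k (∙-congˡ k≈∑h)))
      (sum-closed G resp-U h
        (λ j → ⋃-closed G resp-A disjoint bimodal closed inhabited j (h∈K j)) r∈U)
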